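{- Let $p,q$ be positive integers with $p\ge 2q$. The graph $K_{p/q}$ admits an orientation without alternating odd cycles if and only if $p/q\le 3$.
   Context: The rational complete graph $K_{p/q}$ has vertex set $\{0,1,\dots,p-1\}$, with $a,b$ adjacent iff $q\le|a-b|\le p-q$. An orientation assigns each edge exactly one direction. In an oriented graph, a subgraph that is a cycle is called alternating if at most one of its vertices has both positive in-degree and positive out-degree within that cycle; an alternating odd cycle is an alternating cycle of odd length. -}

module Defs where

open import Data.Fin.Base using (Fin; toℕ)
open import Data.List.Base using (length; filter; allFin)
open import Data.Nat.Base using (ℕ; suc; _∸_; _≤_; _<_; ∣_-_∣; NonZero; ≢-nonZero⁻¹)
open import Data.Nat.Divisibility using (_∣_)
open import Data.Nat.Properties using (_≟_; _≤?_; ∣-∣-comm; ∣n-n∣≡0; n≤0⇒n≡0)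
open import Data.Product.Base using (_×_; _,_)
open import Data.Sum.Base using (_⊎_; inj₁; inj₂)
open import Function.Definitions using (Injective)
open import Relation.Binary.Core using (Rel)
open import Relation.Binary.Definitions using (Decidable; Symmetric; Irreflexive; Asymmetric)
open import Relation.Binary.PropositionalEquality using (_≡_; refl; subst)
open import Relation.Nullary.Decidable using (yes; no; _×-dec_; _⊎-dec_)
open import Relation.Nullary.Negation using (¬_)
open import Level using (0ℓ)

record Graph : Set₁ where
  infix 4 _~_ _~?_
  field
    order    : ℕ
  Vertex : Set
  Vertex = Fin order
  field
    _~_      : Rel Vertex 0ℓ
    _~?_     : Decidable _~_
    ~-sym    : Symmetric _~_
    ~-irrefl : Irreflexive _≡_ _~_

rationalComplete : (p q : ℕ) .{{_ : NonZero q}} → Graph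
rationalComplete p q = record
  { order    = p
  ; _~_      = λ a b → q ≤ ∣ toℕ a - toℕ b ∣ × ∣ toℕ a - toℕ b ∣ ≤ p ∸ q
  ; _~?_     = λ a b → (q ≤? ∣ toℕ a - toℕ b ∣) ×-dec (∣ toℕ a - toℕ b ∣ ≤? p ∸ q)
  ; ~-sym    = λ {a} {b} → subst (λ d → q ≤ d × d ≤ p ∸ q) (∣-∣-comm (toℕ a) (toℕ b))
  ; ~-irrefl = λ { {a} refl (q≤d , _) →
      ≢-nonZero⁻¹ q (n≤0⇒n≡0 (subst (q ≤_) (∣n-n∣≡0 (toℕ a)) q≤d)) }
  }

-- u ⟶ v: the edge uv is directed from u to v.
record Orientation (G : Graph) : Set₁ where
  open Graph G
  infix 4 _⟶_
  field
    _⟶_     : Rel Vertex 0ℓ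
    ⟶⇒~     : ∀ {u v} → u ⟶ v → u ~ v
    directed : ∀ {u v} → u ~ v → u ⟶ v ⊎ v ⟶ u
    ⟶-asym  : Asymmetric _⟶_

  infix 4 _⟶?_
  _⟶?_ : Decidable _⟶_
  u ⟶? v with u ~? v
  ... | no ¬uv = no (λ a → ¬uv (⟶⇒~ a))
  ... | yes uv with directed uv
  ...   | inj₁ a = yes a
  ...   | inj₂ b = no (⟶-asym b)

-- j is the successor of i in the cyclic order 0, 1, …, n − 1, 0.
CyclicSuc : ∀ {n} → Rel (Fin n) 0ℓ
CyclicSuc {n} i j = toℕ j ≡ suc (toℕ i) ⊎ (suc (toℕ i) ≡ n × toℕ j ≡ 0)

cyclicSuc? : ∀ {n} → Decidable (CyclicSuc {n})
cyclicSuc? {n} i j =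
  (toℕ j ≟ suc (toℕ i)) ⊎-dec ((suc (toℕ i) ≟ n) ×-dec (toℕ j ≟ 0))

-- A cycle subgraph (not necessarily induced), given by a cyclic enumeration of
-- its vertices; its edges join cyclically consecutive vertices.
record Cycle (G : Graph) : Set where
  open Graph G
  field
    size      : ℕ
    3≤size    : 3 ≤ size
    vertex    : Fin size → Vertex
    injective : Injective _≡_ _≡_ vertex
    adjacent  : ∀ {i j} → CyclicSuc i j → vertex i ~ vertex j

  Consecutive : Rel (Fin size) 0ℓ
  Consecutive i j = CyclicSuc i j ⊎ CyclicSuc j i

  consecutive? : Decidable Consecutive
  consecutive? i j = cyclicSuc? i j ⊎-dec cyclicSuc? j i

  Odd : Set
  Odd = ¬ (2 ∣ size)

module _ {G : Graph} (O : Orientation G) (C : Cycle G) where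
  open Orientation O
  open Cycle C

  -- Degrees within C: only arcs lying on edges of C are counted.
  inDegree outDegree : Fin size → ℕ
  inDegree i =
    length (filter (λ j → consecutive? i j ×-dec (vertex j ⟶? vertex i)) (allFin size))
  outDegree i =
    length (filter (λ j → consecutive? i j ×-dec (vertex i ⟶? vertex j)) (allFin size))

  Mixed : Fin size → Set
  Mixed i = 0 < inDegree i × 0 < outDegree i

  Alternating : Set
  Alternating = ∀ i j → Mixed i → Mixed j → i ≡ j

NoAlternatingOddCycle : {G : Graph} → Orientation G → Set
NoAlternatingOddCycle {G} O = (C : Cycle G) → Cycle.Odd C → ¬ Alternating O C

{-# OPTIONS --safe #-}

-- If p ≤ 3q, then v ↦ ⌊v/q⌋ is a proper 3-colouring; orient every edge along
-- the directed triangle of colours.  The neighbours of a non-mixed vertex of a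
-- cycle then have equal colours, so in a cycle of odd length with at most one
-- mixed vertex m, hopping over the vertices m+2, m+4, … shows that m+1 and m
-- have the same colour, although they are adjacent.
--
-- If p > 3q, the vertices 0, …, 3q carry a copy of K_{(3q+1)/q}.
-- Without alternating odd cycles all triangles are cyclically oriented.  The
-- triangles {x, x+q, x+2q} (mod 3q+1) form a sequence in which consecutive ones
-- share an edge, so, up to reversing all arcs, x ⟶ x+q and x ⟶ x+q+1 for
-- all x.  Then 0, 2q+1, 1, 2q+2, 2, …, 3q, q is an odd cycle whose only mixed
-- vertex is 0.
module Submission where

open import Defs
open import Data.Integer.Base using (+_)
open import Data.Nat.Base using (ℕ; _*_; _≥_; NonZero)
open import Data.Product.Base using (Σ)
open import Data.Rational.Unnormalised.Base using (_/_; _≤_)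
open import Function.Bundles using (_⇔_)

open import Data.Fin.Base using (Fin; toℕ; fromℕ<)
open import Data.Fin.Patterns using (0F; 1F; 2F)
open import Data.Fin.Properties using (toℕ-fromℕ<; toℕ-injective; toℕ<n)
import Data.Integer.Base as ℤ
import Data.Integer.Properties as ℤ
open import Data.List.Base using (length; filter; allFin; _∷_)
open import Data.List.Membership.Propositional using (_∈_)
open import Data.List.Membership.Propositional.Properties using (∈-filter⁺; ∈-filter⁻; ∈-length; ∈-allFin)
open import Data.List.Relation.Unary.Any using (here)
open import Data.Nat.Base using (zero; suc; _+_; _∸_; _<_; _⊔_; ∣_-_∣; z≤n; s≤s; >-nonZero)
import Data.Nat.Base as ℕ
open import Data.Nat.Divisibility using (divides; ∣⇒≤)
open import Data.Nat.DivMod using (_%_; _mod_; m≡m%n+[m/n]*n; [m+kn]%n≡m%n; [m+n]%n≡m%n; n%n≡0; m%n<n; m<n⇒m%n≡m; m<n*o⇒m/o<n)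
open import Data.Nat.Properties
open import Data.Nat.Tactic.RingSolver using (solve-∀)
open import Data.Product.Base using (∃; _×_; _,_; proj₁; proj₂)
open import Data.Rational.Unnormalised.Base using (*≤*)
open import Data.Sum.Base using (_⊎_; inj₁; inj₂; swap)
open import Function.Base using (_∘_; flip; case_of_)
open import Function.Bundles using (mk⇔)
open import Relation.Binary.PropositionalEquality using (_≡_; _≢_; refl; sym; trans; cong; subst; subst₂; module ≡-Reasoning)
open import Relation.Nullary.Decidable using (yes; no)
open import Relation.Nullary.Negation using (¬_; contradiction)
open import Relation.Unary using (Decidable)

-- Parity, residues and cyclic indices

even⊎odd : ∀ n → (∃ λ k → n ≡ k * 2) ⊎ (∃ λ k → n ≡ suc (k * 2))
even⊎odd zero = inj₁ (0 , refl)
even⊎odd (suc n) with even⊎odd n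
... | inj₁ (k , refl) = inj₂ (k , refl)
... | inj₂ (k , refl) = inj₁ (suc k , refl)

double≢suc-double : ∀ k l → k * 2 ≢ suc (l * 2)
double≢suc-double (suc k) (suc l) eq = double≢suc-double k l (suc-injective (suc-injective eq))

suc-% : ∀ i n .{{_ : NonZero n}} → suc i % n ≡ suc (i % n) % n
suc-% i n = begin
  suc i % n                            ≡⟨ cong (λ x → suc x % n) (m≡m%n+[m/n]*n i n) ⟩
  (suc (i % n) + i ℕ./ n * n) % n      ≡⟨ [m+kn]%n≡m%n (suc (i % n)) (i ℕ./ n) n ⟩
  suc (i % n) % n                      ∎
  where open ≡-Reasoning

toℕ-mod : ∀ i n .{{_ : NonZero n}} → toℕ (i mod n) ≡ i % n
toℕ-mod i n = toℕ-fromℕ< (m%n<n i n)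

-- Cancelling `m` from the division identity would make `d` a multiple of `n`, impossible for
-- `0 < d < n`.
[d+m]%n≢m : ∀ {d m n} .{{_ : NonZero d}} .{{_ : NonZero n}} → d < n → (d + m) % n ≢ m
[d+m]%n≢m {d} {m} {n} d<n eq = <⇒≱ d<n (∣⇒≤ (divides ((d + m) ℕ./ n) (+-cancelˡ-≡ m d _ (begin
  m + d                                ≡⟨ +-comm m d ⟩
  d + m                                ≡⟨ m≡m%n+[m/n]*n (d + m) n ⟩
  (d + m) % n + (d + m) ℕ./ n * n      ≡⟨ cong (_+ (d + m) ℕ./ n * n) eq ⟩
  m + (d + m) ℕ./ n * n                ∎))))
  where open ≡-Reasoning

-- Allows walking around a cycle along natural numbers. The two cases are an ordinary step and the
-- wrap from the last index to 0.
cyclicSuc-mod : ∀ i n .{{_ : NonZero n}} → CyclicSuc (i mod n) (suc i mod n)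
cyclicSuc-mod i n with m≤n⇒m<n∨m≡n (m%n<n i n)
... | inj₁ lt = inj₁ (begin
  toℕ (suc i mod n)      ≡⟨ toℕ-mod (suc i) n ⟩
  suc i % n              ≡⟨ suc-% i n ⟩
  suc (i % n) % n        ≡⟨ m<n⇒m%n≡m lt ⟩
  suc (i % n)            ≡⟨ cong suc (toℕ-mod i n) ⟨
  suc (toℕ (i mod n))    ∎)
  where open ≡-Reasoning
... | inj₂ eq = inj₂ (trans (cong suc (toℕ-mod i n)) eq , (begin
  toℕ (suc i mod n)      ≡⟨ toℕ-mod (suc i) n ⟩
  suc i % n              ≡⟨ suc-% i n ⟩
  suc (i % n) % n        ≡⟨ cong (_% n) eq ⟩
  n % n                  ≡⟨ n%n≡0 n ⟩
  0                      ∎))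
  where open ≡-Reasoning

-- Mixed vertices and reversal of arcs

length-filter>0⁻ : ∀ {n} {P : Fin n → Set} (P? : Decidable P) →
                   0 < length (filter P? (allFin n)) → ∃ P
length-filter>0⁻ {n} P? lt with filter P? (allFin n) in eq
... | x ∷ _ = x , proj₂ (∈-filter⁻ P? {xs = allFin n} (subst (x ∈_) (sym eq) (here refl)))

length-filter>0⁺ : ∀ {n} {P : Fin n → Set} (P? : Decidable P) →
                   ∃ P → 0 < length (filter P? (allFin n))
length-filter>0⁺ P? (i , pi) = ∈-length (∈-filter⁺ P? (∈-allFin i) pi)

module _ {G : Graph} (O : Orientation G) (C : Cycle G) where
  open Orientation O
  open Cycle C

  -- Degrees matter only through their positivity, so a witnessing arc replaces the count.
  HasInArc HasOutArc : Fin size → Set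
  HasInArc  i = ∃ λ j → Consecutive i j × vertex j ⟶ vertex i
  HasOutArc i = ∃ λ j → Consecutive i j × vertex i ⟶ vertex j

  mixed⁺ : ∀ {i} → HasInArc i → HasOutArc i → Mixed O C i
  mixed⁺ inArc outArc = length-filter>0⁺ _ inArc , length-filter>0⁺ _ outArc

  mixed⁻ : ∀ {i} → Mixed O C i → HasInArc i × HasOutArc i
  mixed⁻ (in>0 , out>0) = length-filter>0⁻ _ in>0 , length-filter>0⁻ _ out>0

reverse : ∀ {G} → Orientation G → Orientation G
reverse {G} O = record
  { _⟶_      = flip _⟶_
  ; ⟶⇒~      = Graph.~-sym G ∘ ⟶⇒~
  ; directed = swap ∘ directed
  ; ⟶-asym   = ⟶-asym
  }
  where open Orientation O

-- Reversal exchanges in-arcs and out-arcs, hence keeps the same vertices mixed. This lets the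
-- direction of one chosen edge be fixed without loss of generality.
reverse-noAlternatingOddCycle : ∀ {G} {O : Orientation G} →
  NoAlternatingOddCycle O → NoAlternatingOddCycle (reverse O)
reverse-noAlternatingOddCycle {O = O} noAlt C odd alt =
  noAlt C odd λ i j mi mj → alt i j (reverse-mixed mi) (reverse-mixed mj)
  where
  reverse-mixed : ∀ {i} → Mixed O C i → Mixed (reverse O) C i
  reverse-mixed mi with inArc , outArc ← mixed⁻ O C mi = mixed⁺ (reverse O) C outArc inArc

-- Orientations from 3-colourings

next : Fin 3 → Fin 3
next 0F = 1F
next 1F = 2F
next 2F = 0F

next-injective : ∀ {a b} → next a ≡ next b → a ≡ b
next-injective {0F} {0F} _ = refl
next-injective {0F} {1F} ()
next-injective {0F} {2F} ()
next-injective {1F} {0F} ()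
next-injective {1F} {1F} _ = refl
next-injective {1F} {2F} ()
next-injective {2F} {0F} ()
next-injective {2F} {1F} ()
next-injective {2F} {2F} _ = refl

≢⇒next : ∀ {a b} → a ≢ b → b ≡ next a ⊎ a ≡ next b
≢⇒next {0F} {0F} a≢b = contradiction refl a≢b
≢⇒next {0F} {1F} _   = inj₁ refl
≢⇒next {0F} {2F} _   = inj₂ refl
≢⇒next {1F} {0F} _   = inj₂ refl
≢⇒next {1F} {1F} a≢b = contradiction refl a≢b
≢⇒next {1F} {2F} _   = inj₁ refl
≢⇒next {2F} {0F} _   = inj₁ refl
≢⇒next {2F} {1F} _   = inj₂ refl
≢⇒next {2F} {2F} a≢b = contradiction refl a≢b

next-asym : ∀ {a b} → b ≡ next a → a ≢ next b
next-asym {0F} refl ()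
next-asym {1F} refl ()
next-asym {2F} refl ()

module ThreeColoured (G : Graph) (colour : Graph.Vertex G → Fin 3)
                     (proper : ∀ {u v} → Graph._~_ G u v → colour u ≢ colour v) where
  open Graph G

  colourOrientation : Orientation G
  colourOrientation = record
    { _⟶_      = λ u v → u ~ v × colour v ≡ next (colour u)
    ; ⟶⇒~      = proj₁
    ; directed = λ u~v → case ≢⇒next (proper u~v) of λ where
        (inj₁ eq) → inj₁ (u~v , eq)
        (inj₂ eq) → inj₂ (~-sym u~v , eq)
    ; ⟶-asym   = λ (_ , eq) (_ , eq′) → next-asym eq eq′
    }

  module _ (C : Cycle G) where
    open Cycle C
    open Orientation colourOrientation

    -- Within the cycle `i` is a source or a sink. At a source both neighbours have the colour after
    -- that of `i`; at a sink both have the colour before it, unique by `next-injective`.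
    nonMixed⇒colour≡ : ∀ {h i j} → CyclicSuc h i → CyclicSuc i j →
      ¬ Mixed colourOrientation C i → colour (vertex h) ≡ colour (vertex j)
    nonMixed⇒colour≡ {h} {i} {j} hi ij ¬mixed
      with directed (adjacent hi) | directed (adjacent ij)
    ... | inj₁ h⟶i | inj₁ i⟶j = contradiction
      (mixed⁺ colourOrientation C (h , inj₂ hi , h⟶i) (j , inj₁ ij , i⟶j)) ¬mixed
    ... | inj₁ (_ , eq) | inj₂ (_ , eq′) = next-injective (trans (sym eq) eq′)
    ... | inj₂ (_ , eq) | inj₁ (_ , eq′) = trans eq (sym eq′)
    ... | inj₂ i⟶h | inj₂ j⟶i = contradiction
      (mixed⁺ colourOrientation C (j , inj₁ ij , j⟶i) (h , inj₂ hi , i⟶h)) ¬mixed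

    instance
      size-nonZero : NonZero size
      size-nonZero = >-nonZero (≤-trans (s≤s z≤n) 3≤size)

    colourAt : ℕ → Fin 3
    colourAt i = colour (vertex (i mod size))

    module _ (m : Fin size)
             (nonMixed : ∀ i → i ≢ m → ¬ Mixed colourOrientation C i) where

      -- The last hop passes over index `suc t * 2 + toℕ m`. The size bound keeps this index from
      -- being `m` again modulo `size`, so the vertex there is not mixed.
      colourAt-hop : ∀ t → t * 2 < size →
        colourAt (suc (toℕ m)) ≡ colourAt (suc (t * 2 + toℕ m))
      colourAt-hop zero    _  = refl
      colourAt-hop (suc t) lt = trans
        (colourAt-hop t (≤-trans (n≤1+n _) (≤-trans (n≤1+n _) lt)))
        (nonMixed⇒colour≡ (cyclicSuc-mod _ size) (cyclicSuc-mod _ size)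
          (nonMixed _ λ eq → [d+m]%n≢m {suc t * 2} lt
            (trans (sym (toℕ-mod _ size)) (cong toℕ eq))))

      oneMixed⇒even : ¬ Odd
      oneMixed⇒even odd with even⊎odd size
      ... | inj₁ (k , eq) = odd (divides k eq)
      -- The hop with `t = k`, the largest permitted, ends at `suc (k * 2 + toℕ m)`, which is
      -- `toℕ m + size` and reduces to `m`.
      ... | inj₂ (k , eq) = proper (adjacent (cyclicSuc-mod (toℕ m) size)) (begin
        colourAt (toℕ m)                 ≡⟨ cong (colour ∘ vertex) (toℕ-injective (begin
          toℕ (toℕ m mod size)                ≡⟨ toℕ-mod _ size ⟩
          toℕ m % size                        ≡⟨ [m+n]%n≡m%n (toℕ m) size ⟨
          (toℕ m + size) % size               ≡⟨ cong (_% size) (trans (+-comm (toℕ m) size) (cong (_+ toℕ m) eq)) ⟩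
          suc (k * 2 + toℕ m) % size          ≡⟨ toℕ-mod _ size ⟨
          toℕ (suc (k * 2 + toℕ m) mod size)  ∎)) ⟩
        colourAt (suc (k * 2 + toℕ m))   ≡⟨ colourAt-hop k (≤-reflexive (sym eq)) ⟨
        colourAt (suc (toℕ m))           ∎)
        where open ≡-Reasoning

  colourOrientation-noAlternatingOddCycle : NoAlternatingOddCycle colourOrientation
  colourOrientation-noAlternatingOddCycle C odd alt =
    -- `alt` singles out an index only when given a mixed one. That case is refuted first; then no
    -- index is mixed and index 0 serves as well as any other.
    oneMixed⇒even C (0 mod size) (λ i _ → nowhereMixed i) odd
    where
    open Cycle C
    instance _ = size-nonZero C
    nowhereMixed : ∀ m → ¬ Mixed colourOrientation C m
    nowhereMixed m mixed = oneMixed⇒even C m (λ i i≢m mi → i≢m (alt i m mi mixed)) odd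

-- Colouring by three blocks of length at most q

module _ (p q : ℕ) .{{_ : NonZero q}} (p≤3q : p ℕ.≤ 3 * q) where
  open Graph (rationalComplete p q)

  block : Vertex → Fin 3
  block v = fromℕ< (m<n*o⇒m/o<n {n = 3} {o = q} (<-≤-trans (toℕ<n v) p≤3q))

  -- Vertices with equal quotients differ only by their remainders, hence by less than `q`.
  block-proper : ∀ {u v} → u ~ v → block u ≢ block v
  block-proper {u} {v} (q≤d , _) eq = <⇒≱ (begin-strict
    ∣ a - b ∣                                        ≡⟨ cong (∣_- b ∣) (m≡m%n+[m/n]*n a q) ⟩
    ∣ a % q + a ℕ./ q * q - b ∣                      ≡⟨ cong (∣ a % q + a ℕ./ q * q -_∣) (m≡m%n+[m/n]*n b q) ⟩
    ∣ a % q + a ℕ./ q * q - b % q + b ℕ./ q * q ∣    ≡⟨ cong (λ x → ∣ a % q + x * q - b % q + b ℕ./ q * q ∣) a/q≡b/q ⟩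
    ∣ a % q + b ℕ./ q * q - b % q + b ℕ./ q * q ∣    ≡⟨ cong (∣_- b % q + b ℕ./ q * q ∣) (+-comm (a % q) _) ⟩
    ∣ b ℕ./ q * q + a % q - b % q + b ℕ./ q * q ∣    ≡⟨ cong (∣ b ℕ./ q * q + a % q -_∣) (+-comm (b % q) _) ⟩
    ∣ b ℕ./ q * q + a % q - b ℕ./ q * q + b % q ∣    ≡⟨ ∣m+n-m+o∣≡∣n-o∣ (b ℕ./ q * q) _ _ ⟩
    ∣ a % q - b % q ∣                                ≤⟨ ∣m-n∣≤m⊔n (a % q) (b % q) ⟩
    a % q ⊔ b % q                                    <⟨ ⊔-pres-<m (m%n<n a q) (m%n<n b q) ⟩
    q                                                ∎) q≤d
    where
    open ≤-Reasoning
    a = toℕ u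
    b = toℕ v
    a/q≡b/q : a ℕ./ q ≡ b ℕ./ q
    a/q≡b/q = trans (sym (toℕ-fromℕ< _)) (trans (cong toℕ eq) (toℕ-fromℕ< _))

-- Zigzag cycles

module Zigzag {G : Graph} (O : Orientation G) (k : ℕ) (0<k : 0 < k) (v : ℕ → Graph.Vertex G)
              (v-injective : ∀ {i j} → i ℕ.≤ k * 2 → j ℕ.≤ k * 2 → v i ≡ v j → i ≡ j)
              (down : ∀ i → i < k → Orientation._⟶_ O (v (suc (i * 2))) (v (i * 2)))
              (up : ∀ i → i < k → Orientation._⟶_ O (v (suc (i * 2))) (v (suc i * 2)))
              (close : Orientation._⟶_ O (v 0) (v (k * 2))) where
  open Graph G
  open Orientation O

  private
    half< : ∀ i → suc (i * 2) ℕ.≤ k * 2 → i < k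
    half< i = *-cancelʳ-< 2 i k

  step : ∀ {n} → n < k * 2 → v n ~ v (suc n)
  step {n} lt with even⊎odd n
  ... | inj₁ (i , refl) = ~-sym (⟶⇒~ (down i (half< i lt)))
  ... | inj₂ (i , refl) = ⟶⇒~ (up i (half< i (<⇒≤ lt)))

  cyclicSuc⇒~ : ∀ {i j : Fin (suc (k * 2))} → CyclicSuc i j → v (toℕ i) ~ v (toℕ j)
  cyclicSuc⇒~ {i} {j} (inj₁ eq) = subst (λ x → v (toℕ i) ~ v x) (sym eq)
    (step (≤-pred (subst (_< suc (k * 2)) eq (toℕ<n j))))
  cyclicSuc⇒~ (inj₂ (eq , eq′)) = subst₂ (λ x y → v x ~ v y) (sym (suc-injective eq)) (sym eq′)
    (~-sym (⟶⇒~ close))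

  zigzag : Cycle G
  zigzag = record
    { size      = suc (k * 2)
    ; 3≤size    = s≤s (*-monoˡ-≤ 2 0<k)
    ; vertex    = v ∘ toℕ
    ; injective = λ {i} {j} eq → toℕ-injective (v-injective (≤-pred (toℕ<n i)) (≤-pred (toℕ<n j)) eq)
    ; adjacent  = cyclicSuc⇒~
    }

  open Cycle zigzag using (Consecutive)

  odd-source : ∀ {x y} i → toℕ x ≡ suc (i * 2) → Consecutive x y → v (toℕ x) ⟶ v (toℕ y)
  odd-source {x} {y} i x≡ consec with ≤-pred (toℕ<n x) | consec
  ... | x≤ | inj₁ (inj₁ y≡1+x)      rewrite y≡1+x | x≡ = up i (half< i x≤)
  -- The wrap-around edge starts at the last index `k * 2`, which is even.
  ... | x≤ | inj₁ (inj₂ (x≡k2 , _)) =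
    contradiction (trans (sym (suc-injective x≡k2)) x≡) (double≢suc-double k i)
  ... | x≤ | inj₂ (inj₁ x≡1+y)      rewrite suc-injective (trans (sym x≡1+y) x≡) | x≡ = down i (half< i x≤)
  ... | x≤ | inj₂ (inj₂ (_ , x≡0))  = contradiction (trans (sym x≡) x≡0) λ ()

  -- The form `suc i * 2` leaves out index 0, from which the closing arc departs; at the last index
  -- that arc is one of the two incoming ones.
  even-sink : ∀ {x y} i → toℕ x ≡ suc i * 2 → Consecutive x y → v (toℕ y) ⟶ v (toℕ x)
  even-sink {x} {y} i x≡ consec with ≤-pred (toℕ<n x) | ≤-pred (toℕ<n y) | consec
  ... | x≤ | y≤ | inj₁ (inj₁ y≡1+x)        rewrite y≡1+x | x≡ = down (suc i) (half< (suc i) y≤)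
  ... | x≤ | y≤ | inj₁ (inj₂ (x≡k2 , y≡0)) rewrite suc-injective x≡k2 | y≡0 = close
  ... | x≤ | y≤ | inj₂ (inj₁ x≡1+y)        rewrite suc-injective (trans (sym x≡1+y) x≡) | x≡ = up i (half< i (<⇒≤ x≤))
  ... | x≤ | y≤ | inj₂ (inj₂ (_ , x≡0))    = contradiction (trans (sym x≡) x≡0) λ ()

  -- Odd indices are sources and positive even indices are sinks. Index 0 receives an arc from index
  -- 1 and sends one to index `k * 2`.
  mixed⇒0 : ∀ {x} → Mixed O zigzag x → toℕ x ≡ 0
  mixed⇒0 {x} mixed with mixed⁻ O zigzag mixed | even⊎odd (toℕ x)
  ... | _ | inj₁ (zero , eq) = eq
  ... | _ , (j , x-j , x⟶j) | inj₁ (suc i , eq) = contradiction (even-sink i eq x-j) (⟶-asym x⟶j)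
  ... | (j , x-j , j⟶x) , _ | inj₂ (i , eq)     = contradiction (odd-source i eq x-j) (⟶-asym j⟶x)

  zigzag-alternating : Alternating O zigzag
  zigzag-alternating i j mi mj = toℕ-injective (trans (mixed⇒0 mi) (sym (mixed⇒0 mj)))

  zigzag-odd : Cycle.Odd zigzag
  zigzag-odd (divides l eq) = double≢suc-double l k (sym eq)

-- Triangles are cyclically oriented

module Triangles {G : Graph} (O : Orientation G) (noAlt : NoAlternatingOddCycle O) where
  open Graph G
  open Orientation O

  -- A transitive triangle is the zigzag with `k = 1` in the order `u`, `w`, `v`: the source `w`
  -- sits at index 1, the sink `v` at index 2, and only `u` is mixed.
  noTransitiveTriangle : ∀ {u v w} → w ⟶ u → w ⟶ v → ¬ (u ⟶ v)
  noTransitiveTriangle {u} {v} {w} wu wv uv = noAlt zigzag zigzag-odd zigzag-alternating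
    where
    corner : ℕ → Vertex
    corner 0             = u
    corner 1             = w
    corner (suc (suc _)) = v

    ⟶⇒≢ : ∀ {x y} → x ⟶ y → x ≢ y
    ⟶⇒≢ xy x≡y = ~-irrefl x≡y (⟶⇒~ xy)

    corner-injective : ∀ {i j} → i ℕ.≤ 2 → j ℕ.≤ 2 → corner i ≡ corner j → i ≡ j
    corner-injective {0} {0} _ _ _  = refl
    corner-injective {0} {1} _ _ eq = contradiction (sym eq) (⟶⇒≢ wu)
    corner-injective {0} {2} _ _ eq = contradiction eq (⟶⇒≢ uv)
    corner-injective {1} {0} _ _ eq = contradiction eq (⟶⇒≢ wu)
    corner-injective {1} {1} _ _ _  = refl
    corner-injective {1} {2} _ _ eq = contradiction eq (⟶⇒≢ wv)
    corner-injective {2} {0} _ _ eq = contradiction (sym eq) (⟶⇒≢ uv)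
    corner-injective {2} {1} _ _ eq = contradiction (sym eq) (⟶⇒≢ wv)
    corner-injective {2} {2} _ _ _  = refl
    corner-injective {suc (suc (suc _))} (s≤s (s≤s ()))
    corner-injective {_} {suc (suc (suc _))} _ (s≤s (s≤s ()))

    corner-down : ∀ i → i < 1 → corner (suc (i * 2)) ⟶ corner (i * 2)
    corner-down zero    _        = wu
    corner-down (suc _) (s≤s ())

    corner-up : ∀ i → i < 1 → corner (suc (i * 2)) ⟶ corner (suc i * 2)
    corner-up zero    _        = wv
    corner-up (suc _) (s≤s ())

    open Zigzag O 1 (s≤s z≤n) corner corner-injective corner-down corner-up uv

  -- Each of the other three completions has a vertex with two out-arcs (`x`, `x` and `z`
  -- respectively) and is therefore transitive.
  cyclicTriangle : ∀ {x y z} → x ⟶ y → y ~ z → x ~ z → y ⟶ z × z ⟶ x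
  cyclicTriangle xy y~z x~z with directed y~z | directed x~z
  ... | inj₁ yz | inj₁ xz = contradiction yz (noTransitiveTriangle xy xz)
  ... | inj₁ yz | inj₂ zx = yz , zx
  ... | inj₂ zy | inj₁ xz = contradiction zy (noTransitiveTriangle xz xy)
  ... | inj₂ zy | inj₂ zx = contradiction xy (noTransitiveTriangle zx zy)

-- The case p > 3q

module Dense (p q : ℕ) .{{_ : NonZero p}} .{{_ : NonZero q}} (3q<p : q + q + q < p) where
  open Graph (rationalComplete p q)

  -- Junk for arguments ≥ p, which do not occur.
  vtx : ℕ → Vertex
  vtx i = i mod p

  toℕ-vtx : ∀ {i} → i ℕ.≤ q + q + q → toℕ (vtx i) ≡ i
  toℕ-vtx {i} i≤3q = trans (toℕ-mod i p) (m<n⇒m%n≡m (≤-<-trans i≤3q 3q<p))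

  -- The upper bound `suc (q + q)` is the value of `p ∸ q` at `p = 3q + 1`; a larger `p` only
  -- relaxes it.
  vtx-~ : ∀ a d {b} → a + d ≡ b → q ℕ.≤ d → d ℕ.≤ suc (q + q) → b ℕ.≤ q + q + q → vtx a ~ vtx b
  vtx-~ a d refl q≤d d≤1+2q b≤3q =
    subst (λ x → q ℕ.≤ x × x ℕ.≤ p ∸ q) (sym dist)
      (q≤d , ≤-trans d≤1+2q (m+n≤o⇒m≤o∸n (suc (q + q)) 3q<p))
    where
    dist : ∣ toℕ (vtx a) - toℕ (vtx (a + d)) ∣ ≡ d
    dist rewrite toℕ-vtx (≤-trans (m≤m+n a d) b≤3q) | toℕ-vtx b≤3q = ∣m-m+n∣≡n a d

  -- For `j` up to `q` these ranges cover 0, ..., 3q, meeting at their ends: `A q` and `B 0` are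
  -- both the vertex `q`. Adding `q` modulo 3q+1 takes `A j` to `B j`, `B j` to `C j` and
  -- `C (suc j)` to `A j`, so no residues modulo 3q+1 are needed.
  A B C : ℕ → Vertex
  A j = vtx j
  B j = vtx (q + j)
  C j = vtx (q + q + j)

  private
    b≤ : ∀ {j} → j ℕ.≤ q → q + j ℕ.≤ q + q + q
    b≤ j≤q = +-mono-≤ (m≤m+n q q) j≤q

    c≤ : ∀ {j} → j ℕ.≤ q → q + q + j ℕ.≤ q + q + q
    c≤ j≤q = +-monoʳ-≤ (q + q) j≤q

    q≤1+2q : q ℕ.≤ suc (q + q)
    q≤1+2q = ≤-trans (m≤m+n q q) (n≤1+n _)

    1+q≤1+2q : suc q ℕ.≤ suc (q + q)
    1+q≤1+2q = s≤s (m≤m+n q q)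

    shift : ∀ m j → j + suc m ≡ m + suc j
    shift = solve-∀

  A~B : ∀ {j} → j ℕ.≤ q → A j ~ B j
  A~B {j} j≤q = vtx-~ j q (+-comm j q) ≤-refl q≤1+2q (b≤ j≤q)

  B~C : ∀ {j} → j ℕ.≤ q → B j ~ C j
  B~C {j} j≤q = vtx-~ (q + j) q (b+q q j) ≤-refl q≤1+2q (c≤ j≤q)
    where
    b+q : ∀ q j → q + j + q ≡ q + q + j
    b+q = solve-∀

  A~C : ∀ {j} → j ℕ.≤ q → A j ~ C j
  A~C {j} j≤q = vtx-~ j (q + q) (+-comm j _) (m≤m+n q q) (n≤1+n _) (c≤ j≤q)

  A~B⁺ : ∀ {j} → j < q → A j ~ B (suc j)
  A~B⁺ {j} j<q = vtx-~ j (suc q) (shift q j) (n≤1+n q) 1+q≤1+2q (b≤ j<q)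

  A~C⁺ : ∀ {j} → j < q → A j ~ C (suc j)
  A~C⁺ {j} j<q = vtx-~ j (suc (q + q)) (shift (q + q) j) q≤1+2q ≤-refl (c≤ j<q)

  B~C⁺ : ∀ {j} → j < q → B j ~ C (suc j)
  B~C⁺ {j} j<q = vtx-~ (q + j) (suc q) (b+1+q q j) (n≤1+n q) 1+q≤1+2q (c≤ j<q)
    where
    b+1+q : ∀ q j → q + j + suc q ≡ q + q + suc j
    b+1+q = solve-∀

  -- Numbers the vertices of the final odd cycle: `A i` at position `i * 2`, `C (suc i)` at position
  -- `suc (i * 2)`.
  zig : ℕ → ℕ
  zig 0             = 0
  zig 1             = q + q + 1
  zig (suc (suc n)) = suc (zig n)

  zig-even : ∀ i → zig (i * 2) ≡ i
  zig-even zero    = refl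
  zig-even (suc i) = cong suc (zig-even i)

  zig-odd : ∀ i → zig (suc (i * 2)) ≡ q + q + suc i
  zig-odd zero    = refl
  zig-odd (suc i) = trans (cong suc (zig-odd i)) (sym (+-suc (q + q) (suc i)))

  zig-even≢odd : ∀ {i} j → i ℕ.≤ q → i ≢ q + q + suc j
  zig-even≢odd j i≤q refl = <⇒≱ (≤-<-trans (m≤m+n q q) (m<m+n (q + q) (s≤s z≤n))) i≤q

  -- Positions of equal parity are separated by the closed forms; for opposite parities, even
  -- positions carry values at most `q` and odd ones values above `q + q`.
  zig-injective : ∀ {i j} → i ℕ.≤ q * 2 → j ℕ.≤ q * 2 → zig i ≡ zig j → i ≡ j
  zig-injective {i} {j} i≤ j≤ eq with even⊎odd i | even⊎odd j
  ... | inj₁ (k , refl) | inj₁ (l , refl) rewrite zig-even k | zig-even l = cong (_* 2) eq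
  ... | inj₁ (k , refl) | inj₂ (l , refl) rewrite zig-even k | zig-odd l =
    contradiction eq (zig-even≢odd l (*-cancelʳ-≤ k q 2 i≤))
  ... | inj₂ (k , refl) | inj₁ (l , refl) rewrite zig-odd k | zig-even l =
    contradiction (sym eq) (zig-even≢odd k (*-cancelʳ-≤ l q 2 j≤))
  ... | inj₂ (k , refl) | inj₂ (l , refl) rewrite zig-odd k | zig-odd l =
    cong (λ x → suc (x * 2)) (suc-injective (+-cancelˡ-≡ (q + q) (suc k) (suc l) eq))

  zig≤ : ∀ {i} → i ℕ.≤ q * 2 → zig i ℕ.≤ q + q + q
  zig≤ {i} i≤ with even⊎odd i
  ... | inj₁ (k , refl) rewrite zig-even k = ≤-trans (*-cancelʳ-≤ k q 2 i≤) (m≤n+m q (q + q))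
  ... | inj₂ (k , refl) rewrite zig-odd k = c≤ (*-cancelʳ-< 2 k q i≤)

  module _ (O : Orientation (rationalComplete p q)) (noAlt : NoAlternatingOddCycle O) where
    open Orientation O
    open Triangles O noAlt

    -- Walks through the triangles B(j+1)C(j+1)A(j), C(j+1)A(j)B(j), A(j)B(j)C(j)
    -- for j = q − 1, …, 0.
    propagate : ∀ i {j} → i + j ≡ q → A q ⟶ B q → A j ⟶ B j
    propagate zero    refl AB = AB
    propagate (suc i) {j} eq AB =
      let j<q     = subst (j <_) eq (s≤s (m≤n+m j i))
          AB⁺     = propagate i (trans (+-suc i j) eq) AB
          BC⁺ , _ = cyclicTriangle AB⁺ (B~C j<q) (A~C j<q)
          CA , _  = cyclicTriangle BC⁺ (~-sym {A j} (A~C⁺ j<q)) (~-sym {A j} (A~B⁺ j<q))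
      in proj₁ (cyclicTriangle CA (A~B (<⇒≤ j<q)) (~-sym {B j} (B~C⁺ j<q)))

    -- Once every `A j ⟶ B j` is known, the triangle on `A j`, `B j` and either `C j` or `C (suc j)`
    -- sends that third vertex to `A j`. Thus `C (suc i)` points to both `A i` and `A (suc i)`, as
    -- the zigzag requires.
    ¬Aq⟶Bq : ¬ (A q ⟶ B q)
    ¬Aq⟶Bq AqBq = noAlt zigzag zigzag-odd zigzag-alternating
      where
      A⟶B : ∀ {j} → j ℕ.≤ q → A j ⟶ B j
      A⟶B {j} j≤q = propagate (q ∸ j) (m∸n+n≡m j≤q) AqBq

      C⟶A : ∀ {j} → j ℕ.≤ q → C j ⟶ A j
      C⟶A j≤q = proj₂ (cyclicTriangle (A⟶B j≤q) (B~C j≤q) (A~C j≤q))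

      C⁺⟶A : ∀ {j} → j < q → C (suc j) ⟶ A j
      C⁺⟶A j<q = proj₂ (cyclicTriangle (A⟶B (<⇒≤ j<q)) (B~C⁺ j<q) (A~C⁺ j<q))

      0<q : 0 < q
      0<q = ℕ.>-nonZero⁻¹ q

      vtx-zig-injective : ∀ {i j} → i ℕ.≤ q * 2 → j ℕ.≤ q * 2 → vtx (zig i) ≡ vtx (zig j) → i ≡ j
      vtx-zig-injective i≤ j≤ eq = zig-injective i≤ j≤
        (trans (sym (toℕ-vtx (zig≤ i≤))) (trans (cong toℕ eq) (toℕ-vtx (zig≤ j≤))))

      open Zigzag O q 0<q (vtx ∘ zig) vtx-zig-injective
        (λ i i<q → subst₂ (λ x y → vtx x ⟶ vtx y) (sym (zig-odd i)) (sym (zig-even i)) (C⁺⟶A i<q))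
        (λ i i<q → subst₂ (λ x y → vtx x ⟶ vtx y) (sym (zig-odd i)) (sym (zig-even (suc i))) (C⟶A i<q))
        -- The closing arc is `A 0 ⟶ B 0`, because `B 0` is the vertex `q`, the value of `zig` at
        -- `q * 2`.
        (subst (λ x → A 0 ⟶ vtx x) (trans (+-identityʳ q) (sym (zig-even q))) (A⟶B z≤n))

  dense⇒alternatingOddCycle : (O : Orientation (rationalComplete p q)) → ¬ NoAlternatingOddCycle O
  dense⇒alternatingOddCycle O noAlt with Orientation.directed O (A~B ≤-refl)
  ... | inj₁ AB = ¬Aq⟶Bq O noAlt AB
  -- In the reversed orientation this arc runs from `A q` to `B q`.
  ... | inj₂ BA = ¬Aq⟶Bq (reverse O) (reverse-noAlternatingOddCycle noAlt) BA

-- The bound p/q ≤ 3 and the equivalence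

/≤3⁺ : ∀ p q .{{_ : NonZero q}} → p ℕ.≤ 3 * q → (+ p) / q ≤ (+ 3) / 1
-- Matching on `suc q` makes the fraction compute, so the order becomes the cross-multiplied
-- `+ p ℤ.* + 1 ℤ.≤ + 3 ℤ.* + suc q`.
/≤3⁺ p (suc q) p≤3q = *≤* (subst (ℤ._≤ + 3 ℤ.* + suc q) (sym (ℤ.*-identityʳ (+ p))) (ℤ.+≤+ p≤3q))

/≤3⁻ : ∀ p q .{{_ : NonZero q}} → (+ p) / q ≤ (+ 3) / 1 → p ℕ.≤ 3 * q
/≤3⁻ p (suc q) (*≤* le) = ℤ.drop‿+≤+ (subst (ℤ._≤ + 3 ℤ.* + suc q) (ℤ.*-identityʳ (+ p)) le)

mainTheorem9 : (p q : ℕ) .{{_ : NonZero p}} .{{_ : NonZero q}} → p ≥ 2 * q →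
    Σ (Orientation (rationalComplete p q)) NoAlternatingOddCycle ⇔ ((+ p) / q ≤ (+ 3) / 1)
mainTheorem9 p q _ = mk⇔ to from
  where
  3*q≡q+q+q : ∀ q → 3 * q ≡ q + q + q
  3*q≡q+q+q = solve-∀

  to : Σ (Orientation (rationalComplete p q)) NoAlternatingOddCycle → (+ p) / q ≤ (+ 3) / 1
  to (O , noAlt) with p ≤? 3 * q
  ... | yes p≤3q = /≤3⁺ p q p≤3q
  ... | no  p≰3q = contradiction noAlt
    (Dense.dense⇒alternatingOddCycle p q (subst (_< p) (3*q≡q+q+q q) (≰⇒> p≰3q)) O)

  from : (+ p) / q ≤ (+ 3) / 1 → Σ (Orientation (rationalComplete p q)) NoAlternatingOddCycle
  from le = colourOrientation , colourOrientation-noAlternatingOddCycle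
    where open ThreeColoured (rationalComplete p q) (block p q (/≤3⁻ p q le)) (block-proper p q (/≤3⁻ p q le))
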